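{- The set of $s$-practical positive integers $n$ satisfying $n^{1/2}\le S_s(n)$ has asymptotic density $0$.
   Context: $s(n)=\sigma(n)-n$ is the sum of proper divisors of $n$, $S_s(n)=\sum_{d\mid n}s(d)$, and a positive integer $n$ is $s$-practical if every positive integer $m\le S_s(n)$ can be written as $\sum_{d\in\mathcal{D}}s(d)$ for some set $\mathcal{D}$ of divisors of $n$. -}

module Defs where

open import Data.Nat using (ℕ; zero; suc; _+_; _*_; _∸_; _≤_; _<_)
open import Data.Nat.Divisibility using (_∣_; _∣?_)
open import Data.List using (List; []; _∷_; filter; map; length; upTo)
open import Data.List.Relation.Binary.Sublist.Propositional using (_⊆_)
open import Data.List.Relation.Unary.All using (All)
open import Data.List.Relation.Unary.Unique.Propositional using (Unique)
open import Data.Product using (Σ; ∃; _×_)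
open import Data.Nat.ListAction using (sum)
open import Relation.Binary.PropositionalEquality using (_≡_)

oneTo : ℕ → List ℕ
oneTo n = map suc (upTo n)

-- positive divisors of n, in increasing order (empty for n = 0)
divisors : ℕ → List ℕ
divisors n = filter (_∣? n) (oneTo n)

σ : ℕ → ℕ
σ n = sum (divisors n)

s : ℕ → ℕ
s n = σ n ∸ n

Sₛ : ℕ → ℕ
Sₛ n = sum (map s (divisors n))

-- n is s-practical: every positive m ≤ S_s(n) is Σ_{d ∈ D} s(d) for a set D of
-- divisors of n; sets of divisors are sublists of the duplicate-free list divisors n.
SPractical : ℕ → Set
SPractical n = (m : ℕ) → 1 ≤ m → m ≤ Sₛ n →
  Σ (List ℕ) (λ D → D ⊆ divisors n × sum (map s D) ≡ m)

-- A set P ⊆ ℕ has asymptotic density 0: for every ε = 1/(k+1) there is N such that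
-- for every x ≥ N, #{n ∈ [1,x] : P n} ≤ ε x.  The count is expressed (without
-- requiring decidability of P) by bounding the length of every duplicate-free list
-- of elements of [1,x] satisfying P.
DensityZero : (ℕ → Set) → Set
DensityZero P = (k : ℕ) → ∃ λ N → (x : ℕ) → N ≤ x →
  (L : List ℕ) → Unique L → All (λ n → 1 ≤ n × n ≤ x × P n) L →
  suc k * length L ≤ x

{-# OPTIONS --safe #-}
-- An s-practical n has at least S_s(n) subset sums of its s(d), so n ≤ S_s(n)² ≤ 4^τ(n) and
-- τ(n) ≥ c log n.  Almost no n has so many divisors, which a weight 1/τ(d) shows without any
-- prime number estimates.  Put f(n) = Σ_{d∣n} 1/τ(d).
--   * Upper bound: Σ_{n≤x} f(n) ≤ x H with H = Σ_{d≤x} 1/(d τ(d)), and τ(d e) ≤ τ(d) τ(e) gives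
--     H² ≤ Σ_{m≤x²} 1/m = O(log x).  So f has mean O((log x)^{1/2}).
--   * Lower bound: write n = a b² with a a product of w distinct primes.  Then τ(n) ≤ 2^w b², and
--     f(n) ≥ (3/2)^w.  Unless b > B (a set of density at most 1/B), τ(n) ≥ c log x forces
--     2^w ≥ c log x / B², and f(n)² ≥ (9/4)^w = 2^w (9/8)^w outgrows log x.
module Submission where

open import Defs
open import Data.Nat
open import Data.Nat.Properties
open import Data.Nat.Divisibility
open import Data.Nat.GCD using (gcd; gcd[m,n]∣m; gcd[m,n]∣n; gcd-greatest; gcd[m,n]≢0; c*gcd[m,n]≡gcd[cm,cn])
open import Data.Nat.DivMod using (m*n/n≡m; m/n*n≡m; m/n*n≤m; /-monoˡ-≤)
open import Data.Nat.ListAction using (sum; product)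
open import Data.Nat.ListAction.Properties using (sum-++)
open import Data.Nat.Primality using (Prime; ¬prime[1]; prime⇒nonZero; prime⇒irreducible; euclidsLemma)
open import Data.Nat.Primality.Factorisation using (PrimeFactorisation; factorise)
open import Data.Nat.Tactic.RingSolver using (solve-∀)
open import Data.List using (List; []; _∷_; [_]; _++_; map; filter; length; concatMap; cartesianProduct; upTo)
open import Data.List.Properties using (map-++; map-∘; length-map; length-++; length-upTo; upTo-∷ʳ)
open import Data.List.Membership.Propositional using (_∈_; lose)
open import Data.List.Membership.Propositional.Properties
open import Data.List.Relation.Binary.Sublist.Propositional using (_⊆_; []; _∷_; _∷ʳ_)
open import Data.List.Relation.Unary.All as All using (All; []; _∷_)
open import Data.List.Relation.Unary.AllPairs using ([]; _∷_)
open import Data.List.Relation.Unary.Any using (here; there)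
open import Data.List.Relation.Unary.Unique.Propositional using (Unique)
import Data.List.Relation.Unary.Unique.Propositional.Properties as Unique
open import Data.Product using (∃; _×_; _,_; proj₁; proj₂; uncurry)
open import Data.Sum using (inj₁; inj₂; [_,_]′)
open import Function using (_∘_; id)
open import Relation.Binary.PropositionalEquality using (_≡_; refl; sym; trans; cong; cong₂; subst; subst₂; ≢-sym; module ≡-Reasoning)
open import Relation.Nullary using (¬_; Dec; yes; no; contradiction)
open import Relation.Unary using (Pred; Decidable)
open import Level using (0ℓ)

private variable
  A B : Set
  f g : A → ℕ

-- Finite sums over lists.

∑ : List A → (A → ℕ) → ℕ
∑ xs f = sum (map f xs)

infixr 5 ∑

syntax ∑ xs (λ x → e) = ∑[ x ∈ xs ] e

∑-++ : ∀ xs ys (f : A → ℕ) → ∑ (xs ++ ys) f ≡ ∑ xs f + ∑ ys f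
∑-++ xs ys f = trans (cong sum (map-++ f xs ys)) (sum-++ (map f xs) (map f ys))

∑-map : ∀ (h : A → B) xs (f : B → ℕ) → ∑ (map h xs) f ≡ ∑ xs (f ∘ h)
∑-map h xs f = cong sum (sym (map-∘ xs))

∑-concatMap : ∀ (h : A → List B) xs (f : B → ℕ) →
  ∑ (concatMap h xs) f ≡ ∑[ x ∈ xs ] ∑ (h x) f
∑-concatMap h []       f = refl
∑-concatMap h (x ∷ xs) f =
  trans (∑-++ (h x) (concatMap h xs) f) (cong (∑ (h x) f +_) (∑-concatMap h xs f))

∑-cong : ∀ xs → (∀ x → f x ≡ g x) → ∑ xs f ≡ ∑ xs g
∑-cong []       f≡g = refl
∑-cong (x ∷ xs) f≡g = cong₂ _+_ (f≡g x) (∑-cong xs f≡g)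

∑-mono : ∀ (xs : List A) → (∀ {x} → x ∈ xs → f x ≤ g x) → ∑ xs f ≤ ∑ xs g
∑-mono []       f≤g = z≤n
∑-mono (x ∷ xs) f≤g = +-mono-≤ (f≤g (here refl)) (∑-mono xs (f≤g ∘ there))

∑-*ˡ : ∀ c xs (f : A → ℕ) → (∑[ x ∈ xs ] c * f x) ≡ c * ∑ xs f
∑-*ˡ c []       f = sym (*-zeroʳ c)
∑-*ˡ c (x ∷ xs) f =
  trans (cong (c * f x +_) (∑-*ˡ c xs f)) (sym (*-distribˡ-+ c (f x) (∑ xs f)))

∑-+ : ∀ xs (f g : A → ℕ) → (∑[ x ∈ xs ] (f x + g x)) ≡ ∑ xs f + ∑ xs g
∑-+ []       f g = refl
∑-+ (x ∷ xs) f g = trans (cong (f x + g x +_) (∑-+ xs f g)) (lem (f x) (g x) (∑ xs f) (∑ xs g))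
  where
  lem : ∀ a b c d → a + b + (c + d) ≡ a + c + (b + d)
  lem = solve-∀

∑-const : ∀ (xs : List A) c → (∑[ x ∈ xs ] c) ≡ length xs * c
∑-const []       c = refl
∑-const (x ∷ xs) c = cong (c +_) (∑-const xs c)

∑-1 : ∀ (xs : List A) → (∑[ x ∈ xs ] 1) ≡ length xs
∑-1 xs = trans (∑-const xs 1) (*-identityʳ _)

∑-swap : ∀ (xs : List A) (ys : List B) (f : A → B → ℕ) →
  (∑[ x ∈ xs ] ∑[ y ∈ ys ] f x y) ≡ (∑[ y ∈ ys ] ∑[ x ∈ xs ] f x y)
∑-swap []       ys f = sym (trans (∑-const ys 0) (*-zeroʳ (length ys)))
∑-swap (x ∷ xs) ys f =
  trans (cong (∑ ys (f x) +_) (∑-swap xs ys f)) (sym (∑-+ ys (f x) _))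

∑-cartesianProduct : ∀ (xs : List A) (ys : List B) (f : A → ℕ) (g : B → ℕ) →
  (∑[ z ∈ cartesianProduct xs ys ] f (proj₁ z) * g (proj₂ z)) ≡ ∑ xs f * ∑ ys g
∑-cartesianProduct []       ys f g = refl
∑-cartesianProduct (x ∷ xs) ys f g = begin
  ∑ (map (x ,_) ys ++ cartesianProduct xs ys) h
    ≡⟨ ∑-++ (map (x ,_) ys) (cartesianProduct xs ys) h ⟩
  ∑ (map (x ,_) ys) h + ∑ (cartesianProduct xs ys) h
    ≡⟨ cong₂ _+_ (trans (∑-map (x ,_) ys h) (∑-*ˡ (f x) ys g)) (∑-cartesianProduct xs ys f g) ⟩
  f x * ∑ ys g + ∑ xs f * ∑ ys g
    ≡⟨ *-distribʳ-+ (∑ ys g) (f x) (∑ xs f) ⟨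
  (f x + ∑ xs f) * ∑ ys g ∎
  where
  open ≡-Reasoning
  h = λ z → f (proj₁ z) * g (proj₂ z)

-- Each step cuts one occurrence of `φ x` out of `ys`; injectivity keeps the images of the remaining
-- entries inside what is left. With constant weight 1 this becomes the tool for comparing
-- cardinalities.
∑-injective : ∀ (φ : A → B) {xs ys} → Unique xs →
  (∀ {u v} → u ∈ xs → v ∈ xs → φ u ≡ φ v → u ≡ v) →
  (∀ {u} → u ∈ xs → φ u ∈ ys) →
  (∀ {u} → u ∈ xs → f u ≤ g (φ u)) →
  ∑ xs f ≤ ∑ ys g
∑-injective φ {[]} _ _ _ _ = z≤n
∑-injective {f = f} {g = g} φ {x ∷ xs} (x∉xs ∷ uxs) inj mem f≤g
  with ys₁ , ys₂ , refl ← ∈-∃++ (mem (here refl)) = begin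
  f x + ∑ xs f
    ≤⟨ +-mono-≤ (f≤g (here refl)) (∑-injective φ uxs (λ p q → inj (there p) (there q)) mem′ (f≤g ∘ there)) ⟩
  g (φ x) + ∑ (ys₁ ++ ys₂) g
    ≡⟨ cong (g (φ x) +_) (∑-++ ys₁ ys₂ g) ⟩
  g (φ x) + (∑ ys₁ g + ∑ ys₂ g)
    ≡⟨ lem (g (φ x)) (∑ ys₁ g) (∑ ys₂ g) ⟩
  ∑ ys₁ g + (g (φ x) + ∑ ys₂ g)
    ≡⟨ ∑-++ ys₁ (φ x ∷ ys₂) g ⟨
  ∑ (ys₁ ++ φ x ∷ ys₂) g ∎
  where
  open ≤-Reasoning
  lem : ∀ a b c → a + (b + c) ≡ b + (a + c)
  lem = solve-∀
  mem′ : ∀ {u} → u ∈ xs → φ u ∈ ys₁ ++ ys₂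
  mem′ u∈xs with ∈-++⁻ ys₁ (mem (there u∈xs))
  ... | inj₁ p         = ∈-++⁺ˡ p
  ... | inj₂ (there p) = ∈-++⁺ʳ ys₁ p
  ... | inj₂ (here eq) =
    contradiction (inj (here refl) (there u∈xs) (sym eq)) (All.lookup x∉xs u∈xs)

∑-unique : ∀ {xs ys} (f : A → ℕ) → Unique xs → (∀ {u} → u ∈ xs → u ∈ ys) → ∑ xs f ≤ ∑ ys f
∑-unique f uxs xs⊆ys = ∑-injective id uxs (λ _ _ eq → eq) xs⊆ys (λ _ → ≤-refl)

length-injective : ∀ (φ : A → B) {xs ys} → Unique xs →
  (∀ {u v} → u ∈ xs → v ∈ xs → φ u ≡ φ v → u ≡ v) →
  (∀ {u} → u ∈ xs → φ u ∈ ys) → length xs ≤ length ys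
length-injective φ {xs} {ys} uxs inj mem =
  subst₂ _≤_ (∑-1 xs) (∑-1 ys) (∑-injective φ uxs inj mem (λ _ → ≤-refl))

length-unique : ∀ {xs ys : List A} → Unique xs → (∀ {u} → u ∈ xs → u ∈ ys) → length xs ≤ length ys
length-unique uxs xs⊆ys = length-injective id uxs (λ _ _ eq → eq) xs⊆ys

-- Indicators and Markov's inequality.

𝟙 : {P : Set} → Dec P → ℕ
𝟙 (yes _) = 1
𝟙 (no  _) = 0

𝟙-yes : {P : Set} (P? : Dec P) → P → 𝟙 P? ≡ 1
𝟙-yes (yes _) p = refl
𝟙-yes (no ¬p) p = contradiction p ¬p

∑-filter : {P : Pred A 0ℓ} (P? : Decidable P) → ∀ xs (f : A → ℕ) →
  ∑ (filter P? xs) f ≡ ∑[ x ∈ xs ] 𝟙 (P? x) * f x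
∑-filter P? []       f = refl
∑-filter P? (x ∷ xs) f with P? x
... | yes _ = cong₂ _+_ (sym (+-identityʳ (f x))) (∑-filter P? xs f)
... | no  _ = ∑-filter P? xs f

∑-𝟙 : {P : Pred A 0ℓ} (P? : Decidable P) → ∀ xs → (∑[ x ∈ xs ] 𝟙 (P? x)) ≡ length (filter P? xs)
∑-𝟙 P? xs = trans (∑-cong xs (λ x → sym (*-identityʳ _))) (trans (sym (∑-filter P? xs (λ _ → 1))) (∑-1 (filter P? xs)))

markov : ∀ c (xs : List A) (f : A → ℕ) → c * (∑[ x ∈ xs ] 𝟙 (c ≤? f x)) ≤ ∑ xs f
markov c xs f = begin
  c * (∑[ x ∈ xs ] 𝟙 (c ≤? f x))   ≡⟨ ∑-*ˡ c xs _ ⟨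
  (∑[ x ∈ xs ] c * 𝟙 (c ≤? f x))   ≤⟨ ∑-mono xs (λ {x} _ → pointwise x) ⟩
  ∑ xs f                           ∎
  where
  open ≤-Reasoning
  pointwise : ∀ x → c * 𝟙 (c ≤? f x) ≤ f x
  pointwise x with c ≤? f x
  ... | yes c≤fx = ≤-trans (≤-reflexive (*-identityʳ c)) c≤fx
  ... | no  _    = ≤-trans (≤-reflexive (*-zeroʳ c)) z≤n

-- Initial segments and divisor lists.

∈-oneTo⁺ : ∀ {n d} → 1 ≤ d → d ≤ n → d ∈ oneTo n
∈-oneTo⁺ {d = suc d} _ d≤n = ∈-map⁺ suc (∈-upTo⁺ d≤n)

∈-oneTo⁻ : ∀ {n d} → d ∈ oneTo n → 1 ≤ d × d ≤ n
∈-oneTo⁻ d∈ with _ , i∈ , refl ← ∈-map⁻ suc d∈ = s≤s z≤n , ∈-upTo⁻ i∈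

oneTo-unique : ∀ n → Unique (oneTo n)
oneTo-unique n = Unique.map⁺ suc-injective (Unique.upTo⁺ n)

length-oneTo : ∀ n → length (oneTo n) ≡ n
length-oneTo n = trans (length-map suc (upTo n)) (length-upTo n)

∑-oneTo-suc : ∀ n (f : ℕ → ℕ) → ∑ (oneTo (suc n)) f ≡ ∑ (oneTo n) f + f (suc n)
∑-oneTo-suc n f = begin
  ∑ (map suc (upTo (suc n))) f       ≡⟨ cong (λ l → ∑ (map suc l) f) (upTo-∷ʳ n) ⟨
  ∑ (map suc (upTo n ++ [ n ])) f    ≡⟨ cong (λ l → ∑ l f) (map-++ suc (upTo n) [ n ]) ⟩
  ∑ (oneTo n ++ [ suc n ]) f         ≡⟨ ∑-++ (oneTo n) [ suc n ] f ⟩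
  ∑ (oneTo n) f + (f (suc n) + 0)    ≡⟨ cong (∑ (oneTo n) f +_) (+-identityʳ _) ⟩
  ∑ (oneTo n) f + f (suc n)          ∎
  where open ≡-Reasoning

τ : ℕ → ℕ
τ n = length (divisors n)

∈-divisors⁺ : ∀ {n d} → 1 ≤ n → d ∣ n → d ∈ divisors n
∈-divisors⁺ {n} {zero}  1≤n 0∣n = contradiction (0∣⇒≡0 0∣n) (≢-sym (<⇒≢ 1≤n))
∈-divisors⁺ {n} {suc d} 1≤n d∣n =
  ∈-filter⁺ (_∣? n) (∈-oneTo⁺ (s≤s z≤n) (∣⇒≤ {{>-nonZero 1≤n}} d∣n)) d∣n

∈-divisors⁻ : ∀ {n d} → d ∈ divisors n → 1 ≤ d × d ≤ n × d ∣ n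
∈-divisors⁻ {n} d∈ with p , q ← ∈-filter⁻ (_∣? n) d∈ = proj₁ (∈-oneTo⁻ p) , proj₂ (∈-oneTo⁻ p) , q

divisors-unique : ∀ n → Unique (divisors n)
divisors-unique n = Unique.filter⁺ (_∣? n) (oneTo-unique n)

τ≤n : ∀ n → τ n ≤ n
τ≤n n = ≤-trans (length-unique {ys = oneTo n} (divisors-unique n) (λ d∈ → let 1≤d , d≤n , _ = ∈-divisors⁻ {n} d∈ in ∈-oneTo⁺ 1≤d d≤n))
  (≤-reflexive (length-oneTo n))

1≤τ : ∀ {n} → 1 ≤ n → 1 ≤ τ n
1≤τ {n} 1≤n = length-unique {xs = [ 1 ]} ([] ∷ []) λ { (here refl) → ∈-divisors⁺ 1≤n (1∣ n) }

-- Subset sums of an s-practical number.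

subsetSums : List ℕ → List ℕ
subsetSums []       = [ 0 ]
subsetSums (x ∷ xs) = subsetSums xs ++ map (x +_) (subsetSums xs)

length-subsetSums : ∀ xs → length (subsetSums xs) ≡ 2 ^ length xs
length-subsetSums []       = refl
length-subsetSums (x ∷ xs) = begin
  length (subsetSums xs ++ map (x +_) (subsetSums xs))
    ≡⟨ length-++ (subsetSums xs) ⟩
  length (subsetSums xs) + length (map (x +_) (subsetSums xs))
    ≡⟨ cong (length (subsetSums xs) +_) (trans (length-map (x +_) (subsetSums xs)) (sym (+-identityʳ _))) ⟩
  2 * length (subsetSums xs)
    ≡⟨ cong (2 *_) (length-subsetSums xs) ⟩
  2 * 2 ^ length xs ∎
  where open ≡-Reasoning

∈-subsetSums : ∀ (f : A → ℕ) {D xs} → D ⊆ xs → ∑ D f ∈ subsetSums (map f xs)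
∈-subsetSums f []           = here refl
∈-subsetSums f {xs = x ∷ xs} (y ∷ʳ D⊆xs)   = ∈-++⁺ˡ (∈-subsetSums f D⊆xs)
∈-subsetSums f {xs = x ∷ xs} (refl ∷ D⊆xs) = ∈-++⁺ʳ (subsetSums (map f xs)) (∈-map⁺ (f x +_) (∈-subsetSums f D⊆xs))

-- The `Sₛ n` different targets all occur in one list of subset sums, whose length is `2 ^ τ n`.
SPractical⇒Sₛ≤2^τ : ∀ {n} → SPractical n → Sₛ n ≤ 2 ^ τ n
SPractical⇒Sₛ≤2^τ {n} sp = begin
  Sₛ n                                     ≡⟨ length-oneTo (Sₛ n) ⟨
  length (oneTo (Sₛ n))                    ≤⟨ length-unique (oneTo-unique (Sₛ n)) attained ⟩
  length (subsetSums (map s (divisors n))) ≡⟨ length-subsetSums (map s (divisors n)) ⟩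
  2 ^ length (map s (divisors n))          ≡⟨ cong (2 ^_) (length-map s (divisors n)) ⟩
  2 ^ τ n                                  ∎
  where
  open ≤-Reasoning
  attained : ∀ {m} → m ∈ oneTo (Sₛ n) → m ∈ subsetSums (map s (divisors n))
  attained m∈ with 1≤m , m≤S ← ∈-oneTo⁻ m∈ with D , D⊆ , refl ← sp _ 1≤m m≤S = ∈-subsetSums s D⊆

-- Submultiplicativity of the divisor function.

-- Take `u = gcd d a` and `v = d / u`. As `d` divides both `b * d` and `b * a`, it divides their gcd
-- `b * u`; cancelling `u` leaves `v ∣ b`.
∣-*-split : ∀ a b {d} → 1 ≤ d → d ∣ a * b → ∃ λ u → ∃ λ v → u ∣ a × v ∣ b × d ≡ u * v
∣-*-split a b {d} 1≤d d∣ab with gcd[m,n]∣m d a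
... | divides v d≡v*g = gcd d a , v , gcd[m,n]∣n d a , *-cancelˡ-∣ (gcd d a) gv∣gb , d≡g*v
  where
  d≡g*v : d ≡ gcd d a * v
  d≡g*v = trans d≡v*g (*-comm v (gcd d a))
  instance
    d≢0 : NonZero d
    d≢0 = >-nonZero 1≤d
    g≢0 : NonZero (gcd d a)
    g≢0 = ≢-nonZero (gcd[m,n]≢0 d a (inj₁ (≢-nonZero⁻¹ d)))
  gv∣gb : gcd d a * v ∣ gcd d a * b
  gv∣gb = subst₂ _∣_ d≡g*v
    (trans (sym (c*gcd[m,n]≡gcd[cm,cn] b d a)) (*-comm b (gcd d a)))
    (gcd-greatest (n∣m*n b) (subst (d ∣_) (*-comm a b) d∣ab))

length-cartesianProduct : ∀ (xs : List A) (ys : List B) →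
  length (cartesianProduct xs ys) ≡ length xs * length ys
length-cartesianProduct xs ys = begin
  length (cartesianProduct xs ys)             ≡⟨ ∑-1 (cartesianProduct xs ys) ⟨
  ∑ (cartesianProduct xs ys) (λ _ → 1 * 1)    ≡⟨ ∑-cartesianProduct xs ys (λ _ → 1) (λ _ → 1) ⟩
  ∑ xs (λ _ → 1) * ∑ ys (λ _ → 1)             ≡⟨ cong₂ _*_ (∑-1 xs) (∑-1 ys) ⟩
  length xs * length ys                       ∎
  where open ≡-Reasoning

-- By `∣-*-split`, multiplication maps pairs of divisors of `a` and `b` onto the divisors of
-- `a * b`.
τ-* : ∀ {a b} → 1 ≤ a → 1 ≤ b → τ (a * b) ≤ τ a * τ b
τ-* {a} {b} 1≤a 1≤b = begin
  τ (a * b)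
    ≤⟨ length-unique (divisors-unique (a * b)) split ⟩
  length (map (uncurry _*_) (cartesianProduct (divisors a) (divisors b)))
    ≡⟨ length-map (uncurry _*_) (cartesianProduct (divisors a) (divisors b)) ⟩
  length (cartesianProduct (divisors a) (divisors b))
    ≡⟨ length-cartesianProduct (divisors a) (divisors b) ⟩
  τ a * τ b ∎
  where
  open ≤-Reasoning
  split : ∀ {d} → d ∈ divisors (a * b) → d ∈ map (uncurry _*_) (cartesianProduct (divisors a) (divisors b))
  split d∈ with 1≤d , _ , d∣ab ← ∈-divisors⁻ d∈
           with u , v , u∣a , v∣b , refl ← ∣-*-split a b 1≤d d∣ab =
    ∈-map⁺ (uncurry _*_) (∈-cartesianProduct⁺ (∈-divisors⁺ 1≤a u∣a) (∈-divisors⁺ 1≤b v∣b))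

τ-prime : ∀ {p} → Prime p → τ p ≤ 2
τ-prime {p} pr = length-unique {ys = 1 ∷ p ∷ []} (divisors-unique p) λ d∈ →
  [ (λ { refl → here refl }) , (λ { refl → there (here refl) }) ]′
    (prime⇒irreducible pr (proj₂ (proj₂ (∈-divisors⁻ d∈))))

-- Squarefree numbers and the decomposition `n = a b²`.

-- The index `w` counts the prime factors, and `¬ p ∣ a` keeps them distinct. The inductive form
-- lets proofs remove one prime at a time.
data SquareFree : ℕ → ℕ → Set where
  one   : SquareFree 0 1
  times : ∀ {w a p} → Prime p → ¬ p ∣ a → SquareFree w a → SquareFree (suc w) (p * a)

1≤prime : ∀ {p} → Prime p → 1 ≤ p
1≤prime {p} pr = >-nonZero⁻¹ p {{prime⇒nonZero pr}}

SquareFree⇒1≤ : ∀ {w a} → SquareFree w a → 1 ≤ a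
SquareFree⇒1≤ one            = ≤-refl
SquareFree⇒1≤ (times pr _ q) = *-mono-≤ (1≤prime pr) (SquareFree⇒1≤ q)

SquareFree⇒τ≤2^ : ∀ {w a} → SquareFree w a → τ a ≤ 2 ^ w
SquareFree⇒τ≤2^ one            = ≤-refl
SquareFree⇒τ≤2^ (times pr _ q) = ≤-trans (τ-* (1≤prime pr) (SquareFree⇒1≤ q))
  (*-mono-≤ (τ-prime pr) (SquareFree⇒τ≤2^ q))

-- The prime `p` may sit anywhere in the chain of `times`; the recursion descends to it, removes it
-- and puts the primes passed on the way back.
SquareFree-/ : ∀ {w a p} → Prime p → p ∣ a → SquareFree w a →
  ∃ λ v → ∃ λ b → SquareFree v b × a ≡ p * b × ¬ p ∣ b
SquareFree-/ pr p∣1 one = contradiction (subst Prime (∣1⇒≡1 p∣1) pr) ¬prime[1]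
SquareFree-/ {p = p} pr p∣qa (times {a = a} {p = q} qr q∤a sf) with p ∣? a
... | yes p∣a with v , b , sf′ , refl , p∤b ← SquareFree-/ pr p∣a sf =
  suc v , q * b , times qr (λ q∣b → q∤a (∣n⇒∣m*n p q∣b)) sf′ , lem q p b , p∤qb
  where
  lem : ∀ a b c → a * (b * c) ≡ b * (a * c)
  lem = solve-∀
  p∤qb : ¬ p ∣ q * b
  p∤qb p∣qb with euclidsLemma q b pr p∣qb
  ... | inj₂ p∣b = p∤b p∣b
  ... | inj₁ p∣q with prime⇒irreducible qr p∣q
  ...   | inj₁ refl = ¬prime[1] pr
  ...   | inj₂ refl = q∤a (m∣m*n b)
... | no  p∤a with euclidsLemma q a pr p∣qa
...   | inj₂ p∣a = contradiction p∣a p∤a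
...   | inj₁ p∣q with prime⇒irreducible qr p∣q
...     | inj₁ refl = contradiction pr ¬prime[1]
...     | inj₂ refl = _ , a , sf , refl , p∤a

SquareFreePart : ℕ → Set
SquareFreePart n = ∃ λ w → ∃ λ a → ∃ λ b → SquareFree w a × 1 ≤ b × n ≡ a * (b * b)

-- Primes are absorbed one by one. A prime not dividing `a` joins `a`; otherwise `a = p a′`, and
-- `p (p a′) b² = a′ (p b)²` moves it from `a` to `b`.
squareFreePart-product : ∀ {ps} → All Prime ps → SquareFreePart (product ps)
squareFreePart-product []         = 0 , 1 , 1 , one , ≤-refl , refl
squareFreePart-product {p ∷ _} (pr ∷ prs)
  with w , a , b , sf , 1≤b , eq ← squareFreePart-product prs with p ∣? a
... | no  p∤a = suc w , p * a , b , times pr p∤a sf , 1≤b , trans (cong (p *_) eq) (sym (*-assoc p a (b * b)))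
... | yes p∣a with v , a′ , sf′ , refl , _ ← SquareFree-/ pr p∣a sf =
  v , a′ , p * b , sf′ , *-mono-≤ (1≤prime pr) 1≤b , trans (cong (p *_) eq) (lem p a′ b)
  where
  lem : ∀ p a b → p * (p * a * (b * b)) ≡ a * (p * b * (p * b))
  lem = solve-∀

squareFreePart : ∀ {n} → 1 ≤ n → SquareFreePart n
squareFreePart {n} 1≤n = subst SquareFreePart (sym isFactorisation) (squareFreePart-product factorsPrime)
  where open PrimeFactorisation (factorise n {{>-nonZero 1≤n}})

-- Each new prime p gains a factor 3/2: as τ (p d) ≤ 2 τ d, the divisors p d count at least
-- half as much as the divisors d.
SquareFree-∑-divisors : ∀ {w a} → SquareFree w a → ∀ C (V : ℕ → ℕ) →
  (∀ {d} → 1 ≤ d → d ∣ a → C ≤ V d * τ d) → 3 ^ w * C ≤ 2 ^ w * ∑ (divisors a) V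
SquareFree-∑-divisors one C V hyp = begin
  1 * C            ≡⟨ *-identityˡ C ⟩
  C                ≤⟨ hyp ≤-refl ∣-refl ⟩
  V 1 * 1          ≡⟨ lem (V 1) ⟩
  1 * (V 1 + 0)    ∎
  where
  open ≤-Reasoning
  lem : ∀ v → v * 1 ≡ 1 * (v + 0)
  lem = solve-∀
SquareFree-∑-divisors (times {w} {a} {p} pr p∤a sf) C V hyp = begin
  3 * 3 ^ w * C
    ≡⟨ lem₁ (3 ^ w) C ⟩
  2 * (3 ^ w * C) + 3 ^ w * C
    -- The induction hypothesis is used twice, with `V` for the divisors `d` of `a` and with
    -- `2 * V (p * d)` for the divisors `p * d`; this is why `V` is arbitrary.
    ≤⟨ +-mono-≤ (*-monoʳ-≤ 2 (SquareFree-∑-divisors sf C V (λ 1≤d d∣a → hyp 1≤d (∣n⇒∣m*n p d∣a))))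
                (SquareFree-∑-divisors sf C (λ d → 2 * V (p * d)) hyp′) ⟩
  2 * (2 ^ w * ∑ (divisors a) V) + 2 ^ w * (∑[ d ∈ divisors a ] 2 * V (p * d))
    ≡⟨ cong (λ t → 2 * (2 ^ w * ∑ (divisors a) V) + 2 ^ w * t) (∑-*ˡ 2 (divisors a) (V ∘ (p *_))) ⟩
  2 * (2 ^ w * ∑ (divisors a) V) + 2 ^ w * (2 * ∑ (divisors a) (V ∘ (p *_)))
    ≡⟨ lem₂ (2 ^ w) (∑ (divisors a) V) _ ⟩
  2 * 2 ^ w * (∑ (divisors a) V + ∑ (divisors a) (V ∘ (p *_)))
    ≡⟨ cong (λ t → 2 * 2 ^ w * (∑ (divisors a) V + t)) (∑-map (p *_) (divisors a) V) ⟨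
  2 * 2 ^ w * (∑ (divisors a) V + ∑ (map (p *_) (divisors a)) V)
    ≡⟨ cong (2 * 2 ^ w *_) (∑-++ (divisors a) _ V) ⟨
  2 * 2 ^ w * ∑ (divisors a ++ map (p *_) (divisors a)) V
    ≤⟨ *-monoʳ-≤ (2 * 2 ^ w) (∑-unique V unique sub) ⟩
  2 * 2 ^ w * ∑ (divisors (p * a)) V ∎
  where
  open ≤-Reasoning
  lem₁ : ∀ t c → 3 * t * c ≡ 2 * (t * c) + t * c
  lem₁ = solve-∀
  lem₂ : ∀ t u v → 2 * (t * u) + t * (2 * v) ≡ 2 * t * (u + v)
  lem₂ = solve-∀
  lem₃ : ∀ v t → v * (2 * t) ≡ 2 * v * t
  lem₃ = solve-∀
  instance
    p≢0 : NonZero p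
    p≢0 = prime⇒nonZero pr
  1≤pa : 1 ≤ p * a
  1≤pa = *-mono-≤ (1≤prime pr) (SquareFree⇒1≤ sf)
  hyp′ : ∀ {d} → 1 ≤ d → d ∣ a → C ≤ 2 * V (p * d) * τ d
  hyp′ {d} 1≤d d∣a = begin
    C                            ≤⟨ hyp (*-mono-≤ (1≤prime pr) 1≤d) (*-monoʳ-∣ p d∣a) ⟩
    V (p * d) * τ (p * d)        ≤⟨ *-monoʳ-≤ (V (p * d)) (≤-trans (τ-* (1≤prime pr) 1≤d) (*-monoˡ-≤ (τ d) (τ-prime pr))) ⟩
    V (p * d) * (2 * τ d)        ≡⟨ lem₃ (V (p * d)) (τ d) ⟩
    2 * V (p * d) * τ d          ∎
  unique : Unique (divisors a ++ map (p *_) (divisors a))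
  unique = Unique.++⁺ (divisors-unique a) (Unique.map⁺ (*-cancelˡ-≡ _ _ p) (divisors-unique a)) disjoint
    where
    disjoint : ∀ {d} → ¬ (d ∈ divisors a × d ∈ map (p *_) (divisors a))
    disjoint (d∈ , d∈p) with _ , _ , refl ← ∈-map⁻ (p *_) d∈p =
      p∤a (m*n∣⇒m∣ p _ (proj₂ (proj₂ (∈-divisors⁻ d∈))))
  sub : ∀ {d} → d ∈ divisors a ++ map (p *_) (divisors a) → d ∈ divisors (p * a)
  sub d∈ with ∈-++⁻ (divisors a) d∈
  ... | inj₁ q = ∈-divisors⁺ 1≤pa (∣n⇒∣m*n p (proj₂ (proj₂ (∈-divisors⁻ q))))
  ... | inj₂ q with _ , r , refl ← ∈-map⁻ (p *_) q =
    ∈-divisors⁺ 1≤pa (*-monoʳ-∣ p (proj₂ (proj₂ (∈-divisors⁻ r))))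

-- Total division and counts of multiples.

-- Floor division made total, with value 0 at divisor 0, so that quotients can stand under a sum;
-- `m div n * n ≤ m` remains true there.
_div_ : ℕ → ℕ → ℕ
m div zero  = 0
m div suc n = m / suc n

infixl 7 _div_

div-*≤ : ∀ m n → m div n * n ≤ m
div-*≤ m zero    = z≤n
div-*≤ m (suc n) = m/n*n≤m m (suc n)

*-div≤ : ∀ m n → n * (m div n) ≤ m
*-div≤ m n = ≤-trans (≤-reflexive (*-comm n (m div n))) (div-*≤ m n)

div-exact : ∀ {m n} → 1 ≤ n → n ∣ m → m div n * n ≡ m
div-exact (s≤s _) n∣m = m/n*n≡m n∣m

div-greatest : ∀ {m n q} → 1 ≤ n → q * n ≤ m → q ≤ m div n
div-greatest {m} {suc n} {q} _ qn≤m =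
  ≤-trans (≤-reflexive (sym (m*n/n≡m q (suc n)))) (/-monoˡ-≤ (suc n) qn≤m)

count-multiples : ∀ {d} x → 1 ≤ d → d * (∑[ n ∈ oneTo x ] 𝟙 (d ∣? n)) ≤ x
count-multiples {d} x 1≤d = begin
  d * (∑[ n ∈ oneTo x ] 𝟙 (d ∣? n))            ≡⟨ cong (d *_) (∑-𝟙 (d ∣?_) (oneTo x)) ⟩
  d * length (filter (d ∣?_) (oneTo x))        ≤⟨ *-monoʳ-≤ d (length-unique (Unique.filter⁺ (d ∣?_) (oneTo-unique x)) sub) ⟩
  d * length (map (_* d) (oneTo (x div d)))    ≡⟨ cong (d *_) (trans (length-map (_* d) (oneTo (x div d))) (length-oneTo _)) ⟩
  d * (x div d)                                ≤⟨ *-div≤ x d ⟩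
  x                                            ∎
  where
  open ≤-Reasoning
  sub : ∀ {n} → n ∈ filter (d ∣?_) (oneTo x) → n ∈ map (_* d) (oneTo (x div d))
  sub n∈ with p , divides q refl ← ∈-filter⁻ (d ∣?_) {xs = oneTo x} n∈ with 1≤qd , qd≤x ← ∈-oneTo⁻ {x} p =
    ∈-map⁺ (_* d) (∈-oneTo⁺ (1≤q q 1≤qd) (div-greatest 1≤d qd≤x))
    where
    1≤q : ∀ q → 1 ≤ q * d → 1 ≤ q
    1≤q (suc q) _ = s≤s z≤n

-- This disposes of the `n ≤ x / k`, leaving only `n` whose logarithm is within a constant of that
-- of `x`.
count-small : ∀ {k} x → 1 ≤ k → k * (∑[ n ∈ oneTo x ] 𝟙 (n * k ≤? x)) ≤ x
count-small {k} x 1≤k = begin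
  k * (∑[ n ∈ oneTo x ] 𝟙 (n * k ≤? x))           ≡⟨ cong (k *_) (∑-𝟙 (λ n → n * k ≤? x) (oneTo x)) ⟩
  k * length (filter (λ n → n * k ≤? x) (oneTo x))
    ≤⟨ *-monoʳ-≤ k (length-unique (Unique.filter⁺ (λ n → n * k ≤? x) (oneTo-unique x)) sub) ⟩
  k * length (oneTo (x div k))                    ≡⟨ cong (k *_) (length-oneTo _) ⟩
  k * (x div k)                                   ≤⟨ *-div≤ x k ⟩
  x                                               ∎
  where
  open ≤-Reasoning
  sub : ∀ {n} → n ∈ filter (λ n → n * k ≤? x) (oneTo x) → n ∈ oneTo (x div k)
  sub n∈ with p , nk≤x ← ∈-filter⁻ (λ n → n * k ≤? x) {xs = oneTo x} n∈ =
    ∈-oneTo⁺ (proj₁ (∈-oneTo⁻ {x} p)) (div-greatest 1≤k nk≤x)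

-- 1/B² telescopes: the tail of Σ 1/b² from B + 1 to B + T is at most 1/B − 1/(B + T).
∑-inverse-squares : ∀ {B} x (c : ℕ → ℕ) → 1 ≤ B → (∀ b → 1 ≤ b → b * b * c b ≤ x) →
  ∀ T → B * (B + T) * (∑[ t ∈ oneTo T ] c (B + t)) ≤ T * x
∑-inverse-squares {B} x c 1≤B hyp zero = ≤-reflexive (*-zeroʳ (B * (B + 0)))
∑-inverse-squares {B} x c 1≤B hyp (suc T) = *-cancelˡ-≤ (B + T) {{>-nonZero (≤-trans 1≤B (m≤m+n B T))}} (begin
  (B + T) * (B * (B + suc T) * ∑ (oneTo (suc T)) (c ∘ (B +_)))
    ≡⟨ cong₂ (λ M S → (B + T) * (B * M * S)) (+-suc B T) (∑-oneTo-suc T (c ∘ (B +_))) ⟩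
  (B + T) * (B * suc (B + T) * (S + c (B + suc T)))
    ≡⟨ cong (λ M → (B + T) * (B * suc (B + T) * (S + c M))) (+-suc B T) ⟩
  (B + T) * (B * suc (B + T) * (S + c (suc (B + T))))
    ≡⟨ lem₁ (B + T) B S (c (suc (B + T))) ⟩
  suc (B + T) * (B * (B + T) * S) + B * ((B + T) * suc (B + T) * c (suc (B + T)))
    -- The new term is handled by `M (M + 1) ≤ (M + 1)²` for `M = B + T`.
    ≤⟨ +-mono-≤ (*-monoʳ-≤ (suc (B + T)) (∑-inverse-squares x c 1≤B hyp T))
                (*-monoʳ-≤ B (≤-trans (*-monoˡ-≤ _ (*-monoˡ-≤ (suc (B + T)) (n≤1+n (B + T)))) (hyp (suc (B + T)) (s≤s z≤n)))) ⟩
  suc (B + T) * (T * x) + B * x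
    ≡⟨ lem₂ B T x ⟩
  (B + T) * (suc T * x) ∎)
  where
  open ≤-Reasoning
  S = ∑[ t ∈ oneTo T ] c (B + t)
  lem₁ : ∀ M B S c → M * (B * suc M * (S + c)) ≡ suc M * (B * M * S) + B * (M * suc M * c)
  lem₁ = solve-∀
  lem₂ : ∀ B T x → suc (B + T) * (T * x) + B * x ≡ (B + T) * (suc T * x)
  lem₂ = solve-∀

-- After the sums are swapped, the tail bound with `T = x` gives at most `x² / (B (B + x)) ≤ x / B`.
count-square-multiples : ∀ {B} x → 1 ≤ B →
  B * (∑[ n ∈ oneTo x ] ∑[ t ∈ oneTo x ] 𝟙 ((B + t) * (B + t) ∣? n)) ≤ x
count-square-multiples {B} x 1≤B = *-cancelˡ-≤ (B + x) {{>-nonZero (≤-trans 1≤B (m≤m+n B x))}} (begin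
  (B + x) * (B * (∑[ n ∈ oneTo x ] ∑[ t ∈ oneTo x ] 𝟙 ((B + t) * (B + t) ∣? n)))
    ≡⟨ cong (λ S → (B + x) * (B * S)) (∑-swap (oneTo x) (oneTo x) (λ n t → 𝟙 ((B + t) * (B + t) ∣? n))) ⟩
  (B + x) * (B * (∑[ t ∈ oneTo x ] c (B + t)))
    ≡⟨ lem (B + x) B _ ⟩
  B * (B + x) * (∑[ t ∈ oneTo x ] c (B + t))
    ≤⟨ ∑-inverse-squares x c 1≤B (λ b 1≤b → count-multiples x (*-mono-≤ 1≤b 1≤b)) x ⟩
  x * x
    ≤⟨ *-monoˡ-≤ x (m≤n+m x B) ⟩
  (B + x) * x ∎)
  where
  open ≤-Reasoning
  c : ℕ → ℕ
  c b = ∑[ n ∈ oneTo x ] 𝟙 (b * b ∣? n)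
  lem : ∀ M B S → M * (B * S) ≡ B * M * S
  lem = solve-∀

-- Harmonic sums.

∑-oneTo-+≤ : ∀ m k {c} (f : ℕ → ℕ) → (∀ {i} → m < i → f i ≤ c) →
  ∑ (oneTo (m + k)) f ≤ ∑ (oneTo m) f + k * c
∑-oneTo-+≤ m zero f f≤c = ≤-reflexive (trans (cong (λ l → ∑ (oneTo l) f) (+-identityʳ m)) (sym (+-identityʳ _)))
∑-oneTo-+≤ m (suc k) {c} f f≤c = begin
  ∑ (oneTo (m + suc k)) f                ≡⟨ cong (λ l → ∑ (oneTo l) f) (+-suc m k) ⟩
  ∑ (oneTo (suc (m + k))) f              ≡⟨ ∑-oneTo-suc (m + k) f ⟩
  ∑ (oneTo (m + k)) f + f (suc (m + k))  ≤⟨ +-mono-≤ (∑-oneTo-+≤ m k f f≤c) (f≤c (s≤s (m≤m+n m k))) ⟩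
  ∑ (oneTo m) f + k * c + c              ≡⟨ lem (∑ (oneTo m) f) (k * c) c ⟩
  ∑ (oneTo m) f + suc k * c              ∎
  where
  open ≤-Reasoning
  lem : ∀ a b c → a + b + c ≡ a + (c + b)
  lem = solve-∀

∑-oneTo-mono : ∀ {m n} (f : ℕ → ℕ) → m ≤ n → ∑ (oneTo m) f ≤ ∑ (oneTo n) f
∑-oneTo-mono {m} {n} f m≤n = ∑-unique f (oneTo-unique m)
  (λ i∈ → ∈-oneTo⁺ (proj₁ (∈-oneTo⁻ i∈)) (≤-trans (proj₂ (∈-oneTo⁻ {m} i∈)) m≤n))

-- Dyadic blocks: each [2^j, 2^(j+1)) contributes at most Q.
∑-harmonic : ∀ Q J {y} → y < 2 ^ J → (∑[ m ∈ oneTo y ] Q div m) ≤ J * Q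
∑-harmonic Q zero {zero} _ = z≤n
∑-harmonic Q zero {suc y} (s≤s ())
∑-harmonic Q (suc J) {y} y<2^1+J = begin
  (∑[ m ∈ oneTo y ] Q div m)
    ≤⟨ ∑-oneTo-mono (Q div_) y≤ ⟩
  (∑[ m ∈ oneTo (z + suc z) ] Q div m)
    ≤⟨ ∑-oneTo-+≤ z (suc z) (Q div_) (λ {i} z<i → div-greatest (s≤s z≤n) (≤-trans (*-monoʳ-≤ (Q div i) z<i) (div-*≤ Q i))) ⟩
  (∑[ m ∈ oneTo z ] Q div m) + suc z * (Q div suc z)
    ≤⟨ +-mono-≤ (∑-harmonic Q J (≤-reflexive 1+z≡2^J)) (*-div≤ Q (suc z)) ⟩
  J * Q + Q
    ≡⟨ +-comm (J * Q) Q ⟩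
  suc J * Q ∎
  where
  open ≤-Reasoning
  -- With `z = 2^J − 1`, the last block runs from `z + 1` to `2z + 1`: `suc z` terms, each at most
  -- `Q div suc z`.
  z = pred (2 ^ J)
  1+z≡2^J : suc z ≡ 2 ^ J
  1+z≡2^J = suc-pred (2 ^ J) {{m^n≢0 2 J}}
  lem : ∀ z → suc (z + suc z) ≡ 2 * suc z
  lem = solve-∀
  y≤ : y ≤ z + suc z
  y≤ = s≤s⁻¹ (≤-trans y<2^1+J (≤-reflexive (sym (trans (lem z) (cong (2 *_) 1+z≡2^J)))))

-- The weights `1/(d τ(d))` and the bound on their sum.

-- A common multiple of the numbers τ d * d with 1 ≤ d ≤ x, clearing all denominators.
C : ℕ → ℕ
C x = x ! * x !

1≤C : ∀ x → 1 ≤ C x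
1≤C x = *-mono-≤ (1≤n! x) (1≤n! x)

m∣m! : ∀ {m} → 1 ≤ m → m ∣ m !
m∣m! {suc m} _ = m∣m*n (m !)

-- The weight `1/(d τ(d))` scaled by `C x`.
W : ℕ → ℕ → ℕ
W x d = C x div (τ d * d)

-- Since `τ d ≤ d ≤ x`, both `τ d` and `d` divide `x !`; one factorial of `C x` serves each.
W-exact : ∀ {x d} → 1 ≤ d → d ≤ x → W x d * (τ d * d) ≡ C x
W-exact {x} {d} 1≤d d≤x = div-exact (*-mono-≤ (1≤τ 1≤d) 1≤d)
  (*-pres-∣ (∣-trans (m∣m! (1≤τ 1≤d)) (m≤n⇒m!∣n! (≤-trans (τ≤n d) d≤x)))
            (∣-trans (m∣m! 1≤d) (m≤n⇒m!∣n! d≤x)))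

H : ℕ → ℕ
H x = ∑ (oneTo x) (W x)

-- Submultiplicativity of `τ` gives `1/(τ(d) τ(e)) ≤ 1/τ(d e)`, so the bound depends on the pair
-- only through its product.
W-*≤ : ∀ {x d e} → 1 ≤ d → 1 ≤ e → W x d * W x e ≤ (C x * C x) div (d * e * τ (d * e))
W-*≤ {x} {d} {e} 1≤d 1≤e = div-greatest (*-mono-≤ 1≤de (1≤τ 1≤de)) (begin
  W x d * W x e * (d * e * τ (d * e))        ≤⟨ *-monoʳ-≤ (W x d * W x e) (*-monoʳ-≤ (d * e) (τ-* 1≤d 1≤e)) ⟩
  W x d * W x e * (d * e * (τ d * τ e))      ≡⟨ lem (W x d) (W x e) d e (τ d) (τ e) ⟩
  W x d * (τ d * d) * (W x e * (τ e * e))    ≤⟨ *-mono-≤ (div-*≤ (C x) (τ d * d)) (div-*≤ (C x) (τ e * e)) ⟩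
  C x * C x                                  ∎)
  where
  open ≤-Reasoning
  1≤de = *-mono-≤ 1≤d 1≤e
  lem : ∀ u v d e s t → u * v * (d * e * (s * t)) ≡ u * (s * d) * (v * (t * e))
  lem = solve-∀

-- Pairs (d, e) are grouped by m = d e; each has weight at most Q / (m τ m), and m has τ m of them.
H²≤ : ∀ {x J} → x * x < 2 ^ J → H x * H x ≤ J * (C x * C x)
H²≤ {x} {J} x²<2^J = begin
  H x * H x
    ≡⟨ ∑-cartesianProduct (oneTo x) (oneTo x) (W x) (W x) ⟨
  ∑ pairs (λ z → W x (proj₁ z) * W x (proj₂ z))
    ≤⟨ ∑-injective φ (Unique.cartesianProduct⁺ (oneTo-unique x) (oneTo-unique x)) φ-injective φ∈
         (λ z∈ → let 1≤d , _ , 1≤e , _ = bounds z∈ in W-*≤ {x} 1≤d 1≤e) ⟩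
  ∑ (concatMap divisorPairs (oneTo (x * x))) weight
    ≡⟨ ∑-concatMap divisorPairs (oneTo (x * x)) weight ⟩
  (∑[ m ∈ oneTo (x * x) ] ∑ (divisorPairs m) weight)
    ≤⟨ ∑-mono (oneTo (x * x)) (λ m∈ → fibre (proj₁ (∈-oneTo⁻ {x * x} m∈))) ⟩
  (∑[ m ∈ oneTo (x * x) ] Q div m)
    ≤⟨ ∑-harmonic Q J x²<2^J ⟩
  J * Q ∎
  where
  open ≤-Reasoning
  Q = C x * C x
  pairs = cartesianProduct (oneTo x) (oneTo x)
  φ : ℕ × ℕ → ℕ × ℕ
  -- Keeping `d` beside the product makes `φ` injective, as `e` is recovered by cancelling `d`.
  φ (d , e) = d * e , d
  divisorPairs : ℕ → List (ℕ × ℕ)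
  divisorPairs m = map (m ,_) (divisors m)
  weight : ℕ × ℕ → ℕ
  weight (m , _) = Q div (m * τ m)
  bounds : ∀ {z} → z ∈ pairs → 1 ≤ proj₁ z × proj₁ z ≤ x × 1 ≤ proj₂ z × proj₂ z ≤ x
  bounds z∈ with d∈ , e∈ ← ∈-cartesianProduct⁻ (oneTo x) (oneTo x) z∈ =
    let 1≤d , d≤x = ∈-oneTo⁻ d∈ ; 1≤e , e≤x = ∈-oneTo⁻ e∈ in 1≤d , d≤x , 1≤e , e≤x
  φ-injective : ∀ {u v} → u ∈ pairs → v ∈ pairs → φ u ≡ φ v → u ≡ v
  φ-injective {d , e} {d′ , e′} u∈ _ eq with refl ← cong proj₂ eq =
    cong (d ,_) (*-cancelˡ-≡ e e′ d {{>-nonZero (proj₁ (bounds u∈))}} (cong proj₁ eq))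
  φ∈ : ∀ {z} → z ∈ pairs → φ z ∈ concatMap divisorPairs (oneTo (x * x))
  φ∈ {d , e} z∈ with 1≤d , d≤x , 1≤e , e≤x ← bounds z∈ = ∈-concatMap⁺ divisorPairs
    (lose (∈-oneTo⁺ (*-mono-≤ 1≤d 1≤e) (*-mono-≤ d≤x e≤x))
          (∈-map⁺ (d * e ,_) (∈-divisors⁺ (*-mono-≤ 1≤d 1≤e) (m∣m*n e))))
  fibre : ∀ {m} → 1 ≤ m → ∑ (divisorPairs m) weight ≤ Q div m
  fibre {m} 1≤m = div-greatest 1≤m (begin
    ∑ (divisorPairs m) weight * m          ≡⟨ cong (_* m) (trans (∑-map (m ,_) (divisors m) weight) (∑-const (divisors m) _)) ⟩
    τ m * (Q div (m * τ m)) * m       ≡⟨ lem (τ m) (Q div (m * τ m)) m ⟩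
    Q div (m * τ m) * (m * τ m)       ≤⟨ div-*≤ Q (m * τ m) ⟩
    Q                                 ∎)
    where
    lem : ∀ t q m → t * q * m ≡ q * (m * t)
    lem = solve-∀

-- Mean and large values of the divisor sum of `1/τ`.

-- For `1 ≤ n ≤ x` this is `C x` times the sum of `1/τ(d)` over `d ∣ n`: the factor `d` cancels the
-- one in `W x d`.
F : ℕ → ℕ → ℕ
F x n = ∑[ d ∈ divisors n ] d * W x d

-- After the order of summation is exchanged, `d` has at most `x / d` multiples and so contributes
-- at most `x * W x d`.
∑F≤ : ∀ x → ∑ (oneTo x) (F x) ≤ x * H x
∑F≤ x = begin
  (∑[ n ∈ oneTo x ] ∑[ d ∈ divisors n ] d * W x d)
    ≤⟨ ∑-mono (oneTo x) (λ {n} n∈ → divisor-sum≤ n (proj₂ (∈-oneTo⁻ n∈))) ⟩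
  (∑[ n ∈ oneTo x ] ∑[ d ∈ oneTo x ] 𝟙 (d ∣? n) * (d * W x d))
    ≡⟨ ∑-swap (oneTo x) (oneTo x) (λ n d → 𝟙 (d ∣? n) * (d * W x d)) ⟩
  (∑[ d ∈ oneTo x ] ∑[ n ∈ oneTo x ] 𝟙 (d ∣? n) * (d * W x d))
    ≤⟨ ∑-mono (oneTo x) (λ {d} d∈ → multiples≤ d (proj₁ (∈-oneTo⁻ {x} d∈))) ⟩
  (∑[ d ∈ oneTo x ] x * W x d)
    ≡⟨ ∑-*ˡ x (oneTo x) (W x) ⟩
  x * H x ∎
  where
  open ≤-Reasoning
  divisor-sum≤ : ∀ n → n ≤ x → F x n ≤ ∑[ d ∈ oneTo x ] 𝟙 (d ∣? n) * (d * W x d)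
  divisor-sum≤ n n≤x = begin
    F x n
      ≡⟨ ∑-filter (_∣? n) (oneTo n) (λ d → d * W x d) ⟩
    (∑[ d ∈ oneTo n ] 𝟙 (d ∣? n) * (d * W x d))
      ≤⟨ ∑-oneTo-mono (λ d → 𝟙 (d ∣? n) * (d * W x d)) n≤x ⟩
    (∑[ d ∈ oneTo x ] 𝟙 (d ∣? n) * (d * W x d)) ∎
  multiples≤ : ∀ d → 1 ≤ d → (∑[ n ∈ oneTo x ] 𝟙 (d ∣? n) * (d * W x d)) ≤ x * W x d
  multiples≤ d 1≤d = begin
    (∑[ n ∈ oneTo x ] 𝟙 (d ∣? n) * (d * W x d))
      ≡⟨ ∑-cong (oneTo x) (λ n → *-comm (𝟙 (d ∣? n)) (d * W x d)) ⟩
    (∑[ n ∈ oneTo x ] d * W x d * 𝟙 (d ∣? n))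
      ≡⟨ ∑-*ˡ (d * W x d) (oneTo x) (λ n → 𝟙 (d ∣? n)) ⟩
    d * W x d * (∑[ n ∈ oneTo x ] 𝟙 (d ∣? n))
      ≡⟨ lem d (W x d) _ ⟩
    d * (∑[ n ∈ oneTo x ] 𝟙 (d ∣? n)) * W x d
      ≤⟨ *-monoˡ-≤ (W x d) (count-multiples x 1≤d) ⟩
    x * W x d ∎
    where
    lem : ∀ d w c → d * w * c ≡ d * c * w
    lem = solve-∀

F-lower : ∀ {x n w a} w₀ → 1 ≤ n → n ≤ x → SquareFree w a → a ∣ n → w₀ ≤ w →
  3 ^ w₀ * C x ≤ 2 ^ w₀ * F x n
F-lower {x} {n} {w} {a} w₀ 1≤n n≤x sf a∣n w₀≤w with e , refl ← m≤n⇒∃[o]m+o≡n w₀≤w =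
  *-cancelˡ-≤ (2 ^ e) {{m^n≢0 2 e}} (begin
  2 ^ e * (3 ^ w₀ * C x)
    -- The `e = w − w₀` surplus primes only help, as `(3/2)^e ≥ 1`; the threshold thus depends on
    -- `w₀` alone and is the same for all `n`.
    ≤⟨ *-monoˡ-≤ (3 ^ w₀ * C x) (^-monoˡ-≤ e (n≤1+n 2)) ⟩
  3 ^ e * (3 ^ w₀ * C x)
    ≡⟨ trans (lem (3 ^ e) (3 ^ w₀) (C x)) (cong (_* C x) (sym (^-distribˡ-+-* 3 w₀ e))) ⟩
  3 ^ (w₀ + e) * C x
    ≤⟨ SquareFree-∑-divisors sf (C x) (λ d → d * W x d) exact ⟩
  2 ^ (w₀ + e) * ∑ (divisors a) (λ d → d * W x d)
    ≤⟨ *-monoʳ-≤ (2 ^ (w₀ + e)) (∑-unique (λ d → d * W x d) (divisors-unique a) sub) ⟩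
  2 ^ (w₀ + e) * F x n
    ≡⟨ trans (cong (_* F x n) (^-distribˡ-+-* 2 w₀ e)) (sym (lem (2 ^ e) (2 ^ w₀) (F x n))) ⟩
  2 ^ e * (2 ^ w₀ * F x n) ∎)
  where
  open ≤-Reasoning
  lem : ∀ a b c → a * (b * c) ≡ b * a * c
  lem = solve-∀
  lem′ : ∀ d w t → d * w * t ≡ w * (t * d)
  lem′ = solve-∀
  sub : ∀ {d} → d ∈ divisors a → d ∈ divisors n
  sub d∈ = ∈-divisors⁺ 1≤n (∣-trans (proj₂ (proj₂ (∈-divisors⁻ d∈))) a∣n)
  exact : ∀ {d} → 1 ≤ d → d ∣ a → C x ≤ d * W x d * τ d
  exact {d} 1≤d d∣a = ≤-reflexive (sym (trans (lem′ d (W x d) (τ d))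
    (W-exact 1≤d (≤-trans (∣⇒≤ {{>-nonZero 1≤n}} (∣-trans d∣a a∣n)) n≤x))))

-- Markov's inequality for the mean of `F`, squared so that `H²≤` applies and no square root of `J`
-- appears.
count-F-large : ∀ {x J} w → x * x < 2 ^ J →
  let N = ∑[ n ∈ oneTo x ] 𝟙 (3 ^ w * C x ≤? 2 ^ w * F x n) in
  3 ^ w * 3 ^ w * (N * N) ≤ 2 ^ w * 2 ^ w * (x * x * J)
count-F-large {x} {J} w x²<2^J =
  *-cancelˡ-≤ (C x * C x) {{>-nonZero (*-mono-≤ (1≤C x) (1≤C x))}} (begin
  C x * C x * (3 ^ w * 3 ^ w * (N * N))          ≡⟨ lem₁ (C x) (3 ^ w) N ⟩
  3 ^ w * C x * N * (3 ^ w * C x * N)            ≤⟨ *-mono-≤ first-moment first-moment ⟩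
  2 ^ w * (x * H x) * (2 ^ w * (x * H x))        ≡⟨ lem₂ (2 ^ w) x (H x) ⟩
  2 ^ w * 2 ^ w * (x * x) * (H x * H x)          ≤⟨ *-monoʳ-≤ (2 ^ w * 2 ^ w * (x * x)) (H²≤ {x} {J} x²<2^J) ⟩
  2 ^ w * 2 ^ w * (x * x) * (J * (C x * C x))    ≡⟨ lem₃ (2 ^ w) x J (C x) ⟩
  C x * C x * (2 ^ w * 2 ^ w * (x * x * J))      ∎)
  where
  open ≤-Reasoning
  N = ∑[ n ∈ oneTo x ] 𝟙 (3 ^ w * C x ≤? 2 ^ w * F x n)
  lem₁ : ∀ c t n → c * c * (t * t * (n * n)) ≡ t * c * n * (t * c * n)
  lem₁ = solve-∀
  lem₂ : ∀ t x h → t * (x * h) * (t * (x * h)) ≡ t * t * (x * x) * (h * h)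
  lem₂ = solve-∀
  lem₃ : ∀ t x j c → t * t * (x * x) * (j * (c * c)) ≡ c * c * (t * t * (x * x * j))
  lem₃ = solve-∀
  first-moment : 3 ^ w * C x * N ≤ 2 ^ w * (x * H x)
  first-moment = begin
    3 ^ w * C x * N                       ≤⟨ markov (3 ^ w * C x) (oneTo x) (λ n → 2 ^ w * F x n) ⟩
    (∑[ n ∈ oneTo x ] 2 ^ w * F x n)      ≡⟨ ∑-*ˡ (2 ^ w) (oneTo x) (F x) ⟩
    2 ^ w * ∑ (oneTo x) (F x)             ≤⟨ *-monoʳ-≤ (2 ^ w) (∑F≤ x) ⟩
    2 ^ w * (x * H x)                     ∎

-- Growth of `(9/8)^w`.

-- Bernoulli's inequality `(9/8)^w ≥ 1 + w/8` with denominators cleared.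
bernoulli : ∀ w → 8 ^ w * (8 + w) ≤ 8 * 9 ^ w
bernoulli zero    = ≤-refl
bernoulli (suc w) = begin
  8 * 8 ^ w * (8 + suc w)                   ≤⟨ m≤m+n _ (8 ^ w * w) ⟩
  8 * 8 ^ w * (8 + suc w) + 8 ^ w * w       ≡⟨ lem₁ (8 ^ w) w ⟩
  9 * (8 ^ w * (8 + w))                     ≤⟨ *-monoʳ-≤ 9 (bernoulli w) ⟩
  9 * (8 * 9 ^ w)                           ≡⟨ lem₂ (9 ^ w) ⟩
  8 * (9 * 9 ^ w)                           ∎
  where
  open ≤-Reasoning
  lem₁ : ∀ t w → 8 * t * (8 + suc w) + t * w ≡ 9 * (t * (8 + w))
  lem₁ = solve-∀
  lem₂ : ∀ t → 9 * (8 * t) ≡ 8 * (9 * t)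
  lem₂ = solve-∀

^-distribʳ-* : ∀ a b n → (a * b) ^ n ≡ a ^ n * b ^ n
^-distribʳ-* a b zero    = refl
^-distribʳ-* a b (suc n) = trans (cong (a * b *_) (^-distribʳ-* a b n)) (lem a b (a ^ n) (b ^ n))
  where
  lem : ∀ a b c d → a * b * (c * d) ≡ a * c * (b * d)
  lem = solve-∀

m*m≤n*n⇒m≤n : ∀ {m n} → m * m ≤ n * n → m ≤ n
m*m≤n*n⇒m≤n {m} {n} mm≤nn with m ≤? n
... | yes m≤n = m≤n
... | no  m≰n = contradiction mm≤nn (<⇒≱ (*-mono-< (≰⇒> m≰n) (≰⇒> m≰n)))

-- The hypotheses give `9^w N² ≤ 8^w (10 B²) x²`, while `bernoulli` gives
-- `9^w ≥ 8^w (w/8) ≥ 8^w (10 B⁴)`. Hence `B² N² ≤ x²`; the 80 is the 8 of `bernoulli` times the 10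
-- in the bound on `J`.
count-F-large≤ : ∀ {x J w B N} → 1 ≤ B → 80 * (B * B * (B * B)) ≤ w → J ≤ 2 ^ w * (10 * (B * B)) →
  3 ^ w * 3 ^ w * (N * N) ≤ 2 ^ w * 2 ^ w * (x * x * J) → B * N ≤ x
count-F-large≤ {x} {J} {w} {B} {N} 1≤B w-large J≤ hyp = m*m≤n*n⇒m≤n
  (*-cancelˡ-≤ (80 * (B * B)) {{>-nonZero (*-mono-≤ {1} {80} (s≤s z≤n) (*-mono-≤ 1≤B 1≤B))}}
  (*-cancelˡ-≤ (8 ^ w) {{m^n≢0 8 w}} (begin
  8 ^ w * (80 * (B * B) * (B * N * (B * N)))       ≡⟨ lem₁ (8 ^ w) B N ⟩
  8 ^ w * (80 * (B * B * (B * B))) * (N * N)       ≤⟨ *-monoˡ-≤ (N * N) (*-monoʳ-≤ (8 ^ w) (≤-trans w-large (m≤n+m w 8))) ⟩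
  8 ^ w * (8 + w) * (N * N)                        ≤⟨ *-monoˡ-≤ (N * N) (bernoulli w) ⟩
  8 * 9 ^ w * (N * N)                              ≡⟨ cong (λ t → 8 * t * (N * N)) (^-distribʳ-* 3 3 w) ⟩
  8 * (3 ^ w * 3 ^ w) * (N * N)                    ≡⟨ *-assoc 8 (3 ^ w * 3 ^ w) (N * N) ⟩
  8 * (3 ^ w * 3 ^ w * (N * N))                    ≤⟨ *-monoʳ-≤ 8 hyp ⟩
  8 * (2 ^ w * 2 ^ w * (x * x * J))                ≤⟨ *-monoʳ-≤ 8 (*-monoʳ-≤ (2 ^ w * 2 ^ w) (*-monoʳ-≤ (x * x) J≤)) ⟩
  8 * (2 ^ w * 2 ^ w * (x * x * (2 ^ w * (10 * (B * B)))))
    ≡⟨ lem₂ (2 ^ w) x B ⟩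
  2 ^ w * (2 ^ w * 2 ^ w) * (80 * (B * B) * (x * x))
    ≡⟨ cong (_* (80 * (B * B) * (x * x))) (trans (^-distribʳ-* 2 4 w) (cong (2 ^ w *_) (^-distribʳ-* 2 2 w))) ⟨
  8 ^ w * (80 * (B * B) * (x * x))                 ∎)))
  where
  open ≤-Reasoning
  lem₁ : ∀ t B N → t * (80 * (B * B) * (B * N * (B * N))) ≡ t * (80 * (B * B * (B * B))) * (N * N)
  lem₁ = solve-∀
  lem₂ : ∀ t x B → 8 * (t * t * (x * x * (t * (10 * (B * B))))) ≡ t * (t * t) * (80 * (B * B) * (x * x))
  lem₂ = solve-∀

-- Locating a value between consecutive terms of a sequence.

-- An upward search from `a`. Because `w < g w`, it must stop before `w` reaches `ℓ`, so `ℓ` units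
-- of fuel suffice.
bracket : ∀ (g : ℕ → ℕ) → (∀ w → w < g w) → ∀ {a ℓ} → g a ≤ ℓ →
  ∃ λ w → a ≤ w × g w ≤ ℓ × ℓ < g (suc w)
bracket g w<g {a} {ℓ} ga≤ℓ = search a ℓ ga≤ℓ (m≤n+m ℓ a)
  where
  search : ∀ a fuel → g a ≤ ℓ → ℓ ≤ a + fuel → ∃ λ w → a ≤ w × g w ≤ ℓ × ℓ < g (suc w)
  search a zero ga≤ℓ ℓ≤a =
    contradiction (≤-trans ga≤ℓ (≤-trans ℓ≤a (≤-reflexive (+-identityʳ a)))) (<⇒≱ (w<g a))
  search a (suc fuel) ga≤ℓ ℓ≤a+ with g (suc a) ≤? ℓ
  ... | no  g≰ℓ = a , ≤-refl , ga≤ℓ , ≰⇒> g≰ℓ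
  ... | yes g≤ℓ with w , a<w , rest ← search (suc a) fuel g≤ℓ (≤-trans ℓ≤a+ (≤-reflexive (+-suc a fuel))) =
    w , <⇒≤ a<w , rest

n<2^n : ∀ n → n < 2 ^ n
n<2^n zero    = s≤s z≤n
n<2^n (suc n) = begin-strict
  suc n              <⟨ s≤s (n<2^n n) ⟩
  suc (2 ^ n)        ≤⟨ +-monoˡ-≤ (2 ^ n) (m^n>0 2 n) ⟩
  2 ^ n + 2 ^ n      ≡⟨ cong (2 ^ n +_) (+-identityʳ _) ⟨
  2 ^ suc n          ∎
  where open ≤-Reasoning

term≤∑ : ∀ (f : A → ℕ) {x xs} → x ∈ xs → f x ≤ ∑ xs f
term≤∑ f {xs = x ∷ xs} (here refl) = m≤m+n (f x) (∑ xs f)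
term≤∑ f {xs = x ∷ xs} (there x∈)  = ≤-trans (term≤∑ f x∈) (m≤n+m (∑ xs f) (f x))

2^-cancel-< : ∀ {m n} → 2 ^ m < 2 ^ n → m < n
2^-cancel-< {m} {n} 2^m<2^n with m <? n
... | yes m<n = m<n
... | no  m≮n = contradiction 2^m<2^n (≤⇒≯ (^-monoʳ-≤ 2 (≮⇒≥ m≮n)))

-- Covering by three sparse sets.

-- Compare exponents in `2^ℓ ≤ x < n k ≤ (Sₛ n)² 2^k ≤ 2^(2 τ(n) + k)`.
τ-lower : ∀ {n x k ℓ} → SPractical n → n ≤ Sₛ n ^ 2 → 2 ^ ℓ ≤ x → x < n * k → ℓ < 2 * τ n + k
τ-lower {n} {x} {k} {ℓ} sp n≤S² 2^ℓ≤x x<nk = 2^-cancel-< (begin-strict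
  2 ^ ℓ                     ≤⟨ 2^ℓ≤x ⟩
  x                         <⟨ x<nk ⟩
  n * k                     ≤⟨ *-mono-≤ n≤S² (<⇒≤ (n<2^n k)) ⟩
  Sₛ n ^ 2 * 2 ^ k          ≤⟨ *-monoˡ-≤ (2 ^ k) (^-monoˡ-≤ 2 (SPractical⇒Sₛ≤2^τ {n} sp)) ⟩
  (2 ^ τ n) ^ 2 * 2 ^ k     ≡⟨ cong (_* 2 ^ k) (trans (^-*-assoc 2 (τ n) 2) (cong (2 ^_) (*-comm (τ n) 2))) ⟩
  2 ^ (2 * τ n) * 2 ^ k     ≡⟨ ^-distribˡ-+-* 2 (2 * τ n) k ⟨
  2 ^ (2 * τ n + k)         ∎)
  where open ≤-Reasoning

-- If n = a b² with b ≤ B and a a product of w primes, then 2 τ n + B ≤ scale B w, so τ-lower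
-- turns scale B w₀ ≤ log₂ x into w₀ ≤ w.
scale : ℕ → ℕ → ℕ
scale B w = B + 2 ^ suc w * (B * B)

w<scale : ∀ {B} → 1 ≤ B → ∀ w → w < scale B w
w<scale {B} 1≤B w = begin-strict
  w                           <⟨ n<1+n w ⟩
  suc w                       <⟨ n<2^n (suc w) ⟩
  2 ^ suc w                   ≡⟨ *-identityʳ _ ⟨
  2 ^ suc w * 1               ≤⟨ *-monoʳ-≤ (2 ^ suc w) (*-mono-≤ 1≤B 1≤B) ⟩
  2 ^ suc w * (B * B)         ≤⟨ m≤n+m _ B ⟩
  scale B w                   ∎
  where open ≤-Reasoning

-- The summands match three cases: `n ≤ x / B`; `n = a b²` with `b > B`; and `b ≤ B`, where
-- `τ-lower` forces `a` to have at least `w₀` primes and `F-lower` makes `F x n` large.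
cover : ∀ {B x ℓ w₀ n} → 1 ≤ B → 2 ^ ℓ ≤ x → scale B w₀ ≤ ℓ →
  1 ≤ n → n ≤ x → SPractical n → n ≤ Sₛ n ^ 2 →
  1 ≤ 𝟙 (n * B ≤? x) + (∑[ t ∈ oneTo x ] 𝟙 ((B + t) * (B + t) ∣? n)) + 𝟙 (3 ^ w₀ * C x ≤? 2 ^ w₀ * F x n)
cover {B} {x} {ℓ} {w₀} {n} 1≤B 2^ℓ≤x scale≤ℓ 1≤n n≤x sp n≤S² with n * B ≤? x
... | yes _ = s≤s z≤n
... | no  nB≰x with w , a , b , sf , 1≤b , n≡abb ← squareFreePart 1≤n with B <? b
...   | yes B<b = ≤-trans square-term (m≤m+n _ _)
  where
  open ≤-Reasoning
  t = b ∸ B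
  B+t≡b : B + t ≡ b
  B+t≡b = m+[n∸m]≡n (<⇒≤ B<b)
  square∣n : (B + t) * (B + t) ∣ n
  square∣n = subst (λ c → c * c ∣ n) (sym B+t≡b) (divides a n≡abb)
  t≤x : t ≤ x
  t≤x = begin
    t         ≤⟨ m∸n≤m b B ⟩
    b         ≡⟨ *-identityʳ b ⟨
    b * 1     ≤⟨ *-monoʳ-≤ b 1≤b ⟩
    b * b     ≤⟨ ∣⇒≤ {{>-nonZero 1≤n}} (divides a n≡abb) ⟩
    n         ≤⟨ n≤x ⟩
    x         ∎
  square-term : 1 ≤ ∑[ t ∈ oneTo x ] 𝟙 ((B + t) * (B + t) ∣? n)
  square-term = ≤-trans (≤-reflexive (sym (𝟙-yes ((B + t) * (B + t) ∣? n) square∣n)))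
    (term≤∑ (λ t → 𝟙 ((B + t) * (B + t) ∣? n)) (∈-oneTo⁺ (m<n⇒0<n∸m B<b) t≤x))
...   | no  B≮b = ≤-trans (≤-reflexive (sym (𝟙-yes (3 ^ w₀ * C x ≤? 2 ^ w₀ * F x n)
          (F-lower w₀ 1≤n n≤x sf (divides (b * b) (trans n≡abb (*-comm a (b * b)))) w₀≤w)))) (m≤n+m _ _)
  where
  open ≤-Reasoning
  b≤B = ≮⇒≥ B≮b
  1≤bb = *-mono-≤ 1≤b 1≤b
  τn≤ : τ n ≤ 2 ^ w * (B * B)
  τn≤ = begin
    τ n                  ≡⟨ cong τ n≡abb ⟩
    τ (a * (b * b))      ≤⟨ τ-* (SquareFree⇒1≤ sf) 1≤bb ⟩
    -- The crude `τ (b * b) ≤ b * b ≤ B * B` is affordable because `B` stays fixed while `x` grows.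
    τ a * τ (b * b)      ≤⟨ *-mono-≤ (SquareFree⇒τ≤2^ sf) (≤-trans (τ≤n (b * b)) (*-mono-≤ b≤B b≤B)) ⟩
    2 ^ w * (B * B)      ∎
  ℓ<scale : ℓ < scale B w
  ℓ<scale = begin-strict
    ℓ                          <⟨ τ-lower sp n≤S² 2^ℓ≤x (≰⇒> nB≰x) ⟩
    2 * τ n + B                ≤⟨ +-monoˡ-≤ B (*-monoʳ-≤ 2 τn≤) ⟩
    2 * (2 ^ w * (B * B)) + B  ≡⟨ lem (2 ^ w) B ⟩
    scale B w                  ∎
    where
    lem : ∀ p B → 2 * (p * (B * B)) + B ≡ B + 2 * p * (B * B)
    lem = solve-∀
  w₀≤w : w₀ ≤ w
  -- If `w < w₀`, then `ℓ < scale B w ≤ scale B w₀ ≤ ℓ`.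
  w₀≤w with w₀ ≤? w
  ... | yes p = p
  ... | no ¬p = contradiction (≤-trans ℓ<scale (≤-trans
    (+-monoʳ-≤ B (*-monoˡ-≤ (B * B) (^-monoʳ-≤ 2 (s≤s (<⇒≤ (≰⇒> ¬p)))))) scale≤ℓ)) (<-irrefl refl)

-- Summing `cover` over `L` bounds its length by three counts, each at most `x / B`.
length≤counts : ∀ {B x ℓ w₀} → 1 ≤ B → 2 ^ ℓ ≤ x → x < 2 ^ suc ℓ →
  scale B w₀ ≤ ℓ → ℓ < scale B (suc w₀) → 80 * (B * B * (B * B)) ≤ w₀ →
  ∀ {L} → Unique L → All (λ n → 1 ≤ n × n ≤ x × 1 ≤ n × SPractical n × n ≤ Sₛ n ^ 2) L →
  B * length L ≤ x + x + x
length≤counts {B} {x} {ℓ} {w₀} 1≤B 2^ℓ≤x x<2^1+ℓ scale≤ℓ ℓ<scale w₀-large {L} uL aL = begin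
  B * length L
    ≡⟨ cong (B *_) (∑-1 L) ⟨
  B * (∑[ n ∈ L ] 1)
    ≤⟨ *-monoʳ-≤ B (∑-injective id uL (λ _ _ eq → eq) in-range covered) ⟩
  B * (∑[ n ∈ oneTo x ] χ₁ n + χ₂ n + χ₃ n)
    ≡⟨ cong (B *_) (trans (∑-+ (oneTo x) (λ n → χ₁ n + χ₂ n) χ₃) (cong (_+ ∑ (oneTo x) χ₃) (∑-+ (oneTo x) χ₁ χ₂))) ⟩
  B * (∑ (oneTo x) χ₁ + ∑ (oneTo x) χ₂ + ∑ (oneTo x) χ₃)
    ≡⟨ lem B (∑ (oneTo x) χ₁) (∑ (oneTo x) χ₂) (∑ (oneTo x) χ₃) ⟩
  B * ∑ (oneTo x) χ₁ + B * ∑ (oneTo x) χ₂ + B * ∑ (oneTo x) χ₃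
    ≤⟨ +-mono-≤ (+-mono-≤ (count-small x 1≤B) (count-square-multiples x 1≤B))
                (count-F-large≤ {x} {J} {w₀} 1≤B w₀-large J≤ (count-F-large {x} {J} w₀ x²<2^J)) ⟩
  x + x + x ∎
  where
  open ≤-Reasoning
  -- From `x < 2^(ℓ+1)`, this `J` satisfies `x² < 2^J`, as the harmonic sum up to `x²` requires.
  J = suc ℓ + suc ℓ
  χ₁ χ₂ χ₃ : ℕ → ℕ
  χ₁ n = 𝟙 (n * B ≤? x)
  χ₂ n = ∑[ t ∈ oneTo x ] 𝟙 ((B + t) * (B + t) ∣? n)
  χ₃ n = 𝟙 (3 ^ w₀ * C x ≤? 2 ^ w₀ * F x n)
  lem : ∀ b u v w → b * (u + v + w) ≡ b * u + b * v + b * w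
  lem = solve-∀
  in-range : ∀ {n} → n ∈ L → n ∈ oneTo x
  in-range n∈ = let 1≤n , n≤x , _ = All.lookup aL n∈ in ∈-oneTo⁺ 1≤n n≤x
  covered : ∀ {n} → n ∈ L → 1 ≤ χ₁ n + χ₂ n + χ₃ n
  covered n∈ = let 1≤n , n≤x , _ , sp , n≤S² = All.lookup aL n∈ in
    cover {w₀ = w₀} 1≤B 2^ℓ≤x scale≤ℓ 1≤n n≤x sp n≤S²
  x²<2^J : x * x < 2 ^ J
  x²<2^J = ≤-trans (*-mono-< x<2^1+ℓ x<2^1+ℓ) (≤-reflexive (sym (^-distribˡ-+-* 2 (suc ℓ) (suc ℓ))))
  -- Twice `scale B (suc w₀)` is `2 B + 8 · 2^w₀ B²`; absorbing `2 B` into `2 · 2^w₀ B²` yields the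
  -- constant 10.
  J≤ : J ≤ 2 ^ w₀ * (10 * (B * B))
  J≤ = begin
    J
      ≤⟨ +-mono-≤ ℓ<scale ℓ<scale ⟩
    scale B (suc w₀) + scale B (suc w₀)
      ≡⟨ lem₁ B (2 ^ w₀) ⟩
    1 * (2 * (B * 1)) + 2 ^ w₀ * (8 * (B * B))
      ≤⟨ +-monoˡ-≤ _ (*-mono-≤ (m^n>0 2 w₀) (*-monoʳ-≤ 2 (*-monoʳ-≤ B 1≤B))) ⟩
    2 ^ w₀ * (2 * (B * B)) + 2 ^ w₀ * (8 * (B * B))
      ≡⟨ lem₂ (2 ^ w₀) B ⟩
    2 ^ w₀ * (10 * (B * B)) ∎
    where
    lem₁ : ∀ B p → B + 2 * (2 * p) * (B * B) + (B + 2 * (2 * p) * (B * B)) ≡ 1 * (2 * (B * 1)) + p * (8 * (B * B))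
    lem₁ = solve-∀
    lem₂ : ∀ p B → p * (2 * (B * B)) + p * (8 * (B * B)) ≡ p * (10 * (B * B))
    lem₂ = solve-∀

-- Choice of parameters and conclusion.

theorem6p9 : DensityZero (λ n → 1 ≤ n × SPractical n × n ≤ Sₛ n ^ 2)
theorem6p9 k = 2 ^ scale K w₁ , bound
  where
  -- Three sets, each of size at most `x / K`, together have at most `x / (k + 1)` elements.
  K  = 3 * suc k
  -- The least `w` that `count-F-large≤` admits for `B = K`.
  w₁ = 80 * (K * K * (K * K))
  1≤K : 1 ≤ K
  1≤K = s≤s z≤n
  bound : ∀ x → 2 ^ scale K w₁ ≤ x → ∀ L → Unique L →
    All (λ n → 1 ≤ n × n ≤ x × 1 ≤ n × SPractical n × n ≤ Sₛ n ^ 2) L → suc k * length L ≤ x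
  bound x N≤x L uL aL
    -- The first search finds `ℓ`, the integer part of the binary logarithm of `x`; the second fits
    -- `w₀ ≥ w₁` to `ℓ`, so that `2^w₀` has the order of `log x`.
    with ℓ , a≤ℓ , 2^ℓ≤x , x<2^1+ℓ ← bracket (2 ^_) n<2^n N≤x
    with w₀ , w₁≤w₀ , scale≤ℓ , ℓ<scale ← bracket (scale K) (w<scale 1≤K) a≤ℓ =
    *-cancelˡ-≤ 3 (begin
      3 * (suc k * length L)  ≡⟨ *-assoc 3 (suc k) (length L) ⟨
      K * length L            ≤⟨ length≤counts {w₀ = w₀} 1≤K 2^ℓ≤x x<2^1+ℓ scale≤ℓ ℓ<scale w₁≤w₀ uL aL ⟩
      x + x + x               ≡⟨ lem x ⟩
      3 * x                   ∎)
    where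
    open ≤-Reasoning
    lem : ∀ x → x + x + x ≡ 3 * x
    lem = solve-∀
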